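{- For the online fractional admission control problem described in the context there is an online fractional algorithm (the weight-augmentation algorithm) whose cost is at most $O(\log(mc))$ times the cost of an optimal fractional solution, for arbitrary positive request costs. If all request costs equal $1$, the algorithm's cost is at most $O(\log c)$ times the cost of an optimal fractional solution.
   Context: Instance: a directed graph $G=(V,E)$ with $|E|=m$, each edge $e$ having an integer capacity $c_e>0$, and $c=\max_{e\in E} c_e$. Requests $r_1,r_2,\ldots$ arrive online; each request $r_i$ is a simple path in $G$ with a cost $p_i>0$. An online fractional algorithm maintains, for each arrived request $r_i$, a weight $f_i\ge 0$ that can only increase over time (the rejected fraction; $f_i\ge1$ means fully rejected). At any time, $REQ_e$ is the set of arrived requests whose path contains $e$, $REQ=\bigcup_e REQ_e$, $ALIVE_e=\{i\in REQ_e: f_i<1\}$, $n_e=|ALIVE_e|-c_e$; after processing each request the algorithm must satisfy $\sum_{i\in ALIVE_e} f_i\ge n_e$ for every edge $e$. Its cost is $\sum_{i\in REQ}\min\{f_i,1\}p_i$. The optimal fractional cost is the minimum of $\sum_i f^*_i p_i$ over $f^*_i\in[0,1]$ with $\sum_{i\in REQ_e} f^*_i\ge |REQ_e|-c_e$ for all $e$ (over the whole sequence). An algorithm is $\beta$-competitive if its cost is at most $\beta$ times the optimal cost.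
   Formalization: The request costs p_i, arbitrary positive reals in the statement, are taken to be positive rationals, and the weights f_i and the offline fractional solutions f* are rational as well. -}

module Defs where

open import Data.Nat using (ℕ; zero; suc; _⊔_) renaming (_<_ to _<ℕ_)
open import Data.Nat.Logarithm using (⌊log₂_⌋)
open import Data.Integer using (+_)
open import Data.Rational using (ℚ; _/_; 0ℚ; 1ℚ; _+_; _*_; _-_; _⊓_; _≤_; _<_)
open import Data.Rational.Properties using (_<?_)
open import Data.Fin using (Fin; inject₁)
open import Data.Fin.Properties using (_≟_)
open import Data.Bool using (Bool; true; false; _∧_; if_then_else_)
open import Data.List using (List; []; _∷_)
open import Data.Bool.ListAction using (any)
open import Data.List.Relation.Unary.Unique.Propositional using (Unique)
open import Data.Vec using (Vec; lookup; _∷ʳ_)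
open import Data.Vec as V using ()
open import Data.Product using (_×_; proj₁; proj₂)
open import Data.Unit using (⊤)
open import Data.Empty using (⊥)
open import Function.Definitions using (Injective)
open import Relation.Binary.PropositionalEquality using (_≡_)
open import Relation.Nullary.Decidable using (⌊_⌋)

ℕ→ℚ : ℕ → ℚ
ℕ→ℚ n = + n / 1

record Graph : Set where
  field
    n   : ℕ
    m   : ℕ
    edge : Fin m → Fin n × Fin n
    cap  : Fin m → ℕ

open Graph public

-- well-formedness: E is a set of ordered pairs (no parallel edges),
-- and all capacities are positive
WellFormed : Graph → Set
WellFormed G = Injective _≡_ _≡_ (edge G) × ((e : Fin (m G)) → 0 <ℕ cap G e)

maxCap : (G : Graph) → ℕ
maxCap G = V.foldr _ _⊔_ 0 (V.tabulate (cap G))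

src tgt : (G : Graph) → Fin (m G) → Fin (n G)
src G e = proj₁ (edge G e)
tgt G e = proj₂ (edge G e)

Consecutive : (G : Graph) → List (Fin (m G)) → Set
Consecutive G []            = ⊤
Consecutive G (e ∷ [])      = ⊤
Consecutive G (e ∷ f ∷ es)  = (tgt G e ≡ src G f) × Consecutive G (f ∷ es)

targets : (G : Graph) → List (Fin (m G)) → List (Fin (n G))
targets G []       = []
targets G (e ∷ es) = tgt G e ∷ targets G es

SimplePath : (G : Graph) → List (Fin (m G)) → Set
SimplePath G []       = ⊥
SimplePath G (e ∷ es) = Consecutive G (e ∷ es) × Unique (src G e ∷ targets G (e ∷ es))

record Request (G : Graph) : Set where
  constructor request
  field
    path  : List (Fin (m G))
    price : ℚ

open Request public

ValidRequest : (G : Graph) → Request G → Set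
ValidRequest G r = SimplePath G (path r) × (0ℚ < price r)

ValidSeq : (G : Graph) → {t : ℕ} → Vec (Request G) t → Set
ValidSeq G rs = (i : Fin _) → ValidRequest G (lookup rs i)

uses : {G : Graph} → Fin (m G) → Request G → Bool
uses e r = any (λ e′ → ⌊ e ≟ e′ ⌋) (path r)

Σ : {t : ℕ} → (Fin t → ℚ) → ℚ
Σ {t} f = V.foldr _ _+_ 0ℚ (V.tabulate f)

[_]ℚ : Bool → ℚ → ℚ
[ b ]ℚ q = if b then q else 0ℚ

alive : ℚ → Bool
alive f = ⌊ f <? 1ℚ ⌋

-- An online fractional algorithm (knowing G) maps the sequence of requests
-- arrived so far to the current weights of these requests.
Algorithm : Graph → Set
Algorithm G = {t : ℕ} → Vec (Request G) t → Vec ℚ t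

OnlineFeasible : (G : Graph) → {t : ℕ} → Vec (Request G) t → Vec ℚ t → Set
OnlineFeasible G {t} rs f =
  (e : Fin (m G)) →
    (Σ (λ i → [ uses e (lookup rs i) ∧ alive (lookup f i) ]ℚ 1ℚ) - ℕ→ℚ (cap G e))
      ≤ Σ (λ i → [ uses e (lookup rs i) ∧ alive (lookup f i) ]ℚ (lookup f i))

ValidOnline : (G : Graph) → Algorithm G → Set
ValidOnline G A =
  ({t : ℕ} (rs : Vec (Request G) t) → ValidSeq G rs →
     ((i : Fin t) → 0ℚ ≤ lookup (A rs) i) × OnlineFeasible G rs (A rs))
  × ({t : ℕ} (rs : Vec (Request G) t) (r : Request G) → ValidSeq G (rs ∷ʳ r) →
     (i : Fin t) → lookup (A rs) i ≤ lookup (A (rs ∷ʳ r)) (inject₁ i))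

algCost : (G : Graph) → {t : ℕ} → Vec (Request G) t → Vec ℚ t → ℚ
algCost G rs f = Σ (λ i → (lookup f i ⊓ 1ℚ) * price (lookup rs i))

OfflineFeasible : (G : Graph) → {t : ℕ} → Vec (Request G) t → Vec ℚ t → Set
OfflineFeasible G {t} rs f =
  ((i : Fin t) → (0ℚ ≤ lookup f i) × (lookup f i ≤ 1ℚ))
  × ((e : Fin (m G)) →
      (Σ (λ i → [ uses e (lookup rs i) ]ℚ 1ℚ) - ℕ→ℚ (cap G e))
        ≤ Σ (λ i → [ uses e (lookup rs i) ]ℚ (lookup f i)))

offCost : (G : Graph) → {t : ℕ} → Vec (Request G) t → Vec ℚ t → ℚ
offCost G rs f = Σ (λ i → lookup f i * price (lookup rs i))

AllUnitCost : (G : Graph) → {t : ℕ} → Vec (Request G) t → Set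
AllUnitCost G rs = (i : Fin _) → price (lookup rs i) ≡ 1ℚ

-- O(log x) bound with constant K, read as K · (1 + ⌊log₂ x⌋)
logBound : ℕ → ℕ → ℚ
logBound K x = ℕ→ℚ (K Data.Nat.* suc ⌊log₂ x ⌋)

{-# OPTIONS --safe #-}

-- While some edge e is overloaded, let S be its alive users and n_e = |S| − c_e, and raise every
-- f_i (i ∈ S) by μ (f_i + δ) / p_i, where δ = 1 / (c + 1) and μ is at most every price.  Since n_e is a
-- positive integer, |S| ≤ (c + 1) n_e, so the step increases Σ p_i f_i by μ Σ_S (f_i + δ) ≤ 2 μ n_e.
-- Every offline solution has f*-weight at least n_e on S, so charging a load of μ to each i ∈ S
-- increases Σ f*_i y_i by at least μ n_e; hence Σ p_i f_i ≤ 2 Σ f*_i y_i throughout.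
-- A charge of μ multiplies f_i + δ by 1 + μ / p_i while f_i stays between 0 and 3, so
-- y_i = O(p_i log c).  This bound needs no guess of the optimum and does not depend on m or on the
-- prices, so it covers both the weighted and the unit-cost case.
module Submission where

open import Defs
open import Data.Nat using (ℕ; _∸_; _*_; zero; suc; _⊔_; _^_; ⌊_/2⌋; s≤s; z≤n)
  renaming (_+_ to _+ℕ_; _≤_ to _≤ℕ_; _<_ to _<ℕ_)
import Data.Nat.Properties as ℕₚ
open import Data.Nat.Induction using (<-rec)
open import Data.Nat.Logarithm using (⌊log₂_⌋; ⌊log₂⌋-mono-≤; ⌊log₂⌊n/2⌋⌋≡⌊log₂n⌋∸1)
import Data.Integer as ℤ
import Data.Integer.Properties as ℤₚ
open import Data.Rational using (ℚ; _≤_; _<_; _+_; _-_; -_; _⊓_; 0ℚ; 1ℚ; 1/_; ↥_; mkℚ; toℚᵘ;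
  positive; nonNegative; ≢-nonZero) renaming (_*_ to _*ℚ_)
open import Data.Rational.Properties as ℚₚ using (_≟_; _<?_; module ≤-Reasoning)
open import Data.Rational.Solver using (module +-*-Solver)
open import Data.Rational.Unnormalised as ℚᵘ using (mkℚᵘ; *≡*)
import Data.Rational.Unnormalised.Properties as ℚᵘₚ
open import Data.Bool using (Bool; true; false; _∧_)
open import Data.Fin using (Fin; zero; suc; inject₁; fromℕ)
open import Data.Fin.Properties using (any?)
open import Data.Fin.Relation.Unary.Top using (View; view; ‵fromℕ; ‵inject₁)
open import Data.Vec using (Vec; []; _∷_; lookup; tabulate; _∷ʳ_; init; initLast; foldr)
open import Data.Vec.Properties using (lookup∘tabulate; init-∷ʳ)
open import Data.Product using (Σ-syntax; ∃; _×_; _,_; proj₁; proj₂)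
open import Data.Sum as Sum using (_⊎_; inj₁; inj₂; [_,_]′)
open import Function using (_∘_; id)
open import Data.Empty using (⊥-elim)
open import Relation.Nullary using (¬_; Dec; yes; no)
open import Relation.Nullary.Decidable using (⌊_⌋)
open import Relation.Binary.PropositionalEquality

-- Ordered-field arithmetic of the rationals and the embedding of ℕ.

2ℚ 3ℚ 4ℚ : ℚ
2ℚ = 1ℚ + 1ℚ
3ℚ = 2ℚ + 1ℚ
4ℚ = 3ℚ + 1ℚ

0≤1 : 0ℚ ≤ 1ℚ
0≤1 = ℚₚ.nonNegative⁻¹ 1ℚ

0≤+ : ∀ {p q} → 0ℚ ≤ p → 0ℚ ≤ q → 0ℚ ≤ p + q
0≤+ = ℚₚ.+-mono-≤

0≤* : ∀ {p q} → 0ℚ ≤ p → 0ℚ ≤ q → 0ℚ ≤ p *ℚ q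
0≤* {p} {q} 0≤p 0≤q = ℚₚ.nonNegative⁻¹ (p *ℚ q)
  {{ℚₚ.nonNeg*nonNeg⇒nonNeg p {{nonNegative 0≤p}} q {{nonNegative 0≤q}}}}

0<* : ∀ {p q} → 0ℚ < p → 0ℚ < q → 0ℚ < p *ℚ q
0<* {p} {q} 0<p 0<q = ℚₚ.positive⁻¹ (p *ℚ q)
  {{ℚₚ.pos*pos⇒pos p {{positive 0<p}} q {{positive 0<q}}}}

p+d≡q⇒p≤q : ∀ {p q} d → 0ℚ ≤ d → p + d ≡ q → p ≤ q
p+d≡q⇒p≤q {p} d 0≤d refl = ℚₚ.≤-trans (ℚₚ.≤-reflexive (sym (ℚₚ.+-identityʳ p))) (ℚₚ.+-monoʳ-≤ p 0≤d)

p≤q⇒0≤q-p : ∀ {p q} → p ≤ q → 0ℚ ≤ q - p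
p≤q⇒0≤q-p {p} {q} p≤q = ℚₚ.≤-trans (ℚₚ.≤-reflexive (sym (ℚₚ.+-inverseʳ p))) (ℚₚ.+-monoˡ-≤ (- p) p≤q)

*-monoʳ : ∀ {p q} r → 0ℚ ≤ r → p ≤ q → r *ℚ p ≤ r *ℚ q
*-monoʳ r 0≤r = ℚₚ.*-monoˡ-≤-nonNeg r {{nonNegative 0≤r}}

*-monoˡ : ∀ {p q} r → 0ℚ ≤ r → p ≤ q → p *ℚ r ≤ q *ℚ r
*-monoˡ r 0≤r = ℚₚ.*-monoʳ-≤-nonNeg r {{nonNegative 0≤r}}

-- inv 0ℚ = 0ℚ: the algorithm must also return something on invalid prices.
inv : ℚ → ℚ
inv q with q ≟ 0ℚ
... | yes _  = 0ℚ
... | no q≢0 = (1/ q) {{≢-nonZero q≢0}}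

*-inv : ∀ {q} → 0ℚ < q → q *ℚ inv q ≡ 1ℚ
*-inv {q} 0<q with q ≟ 0ℚ
... | yes q≡0 = ⊥-elim (ℚₚ.<-irrefl (sym q≡0) 0<q)
... | no q≢0  = ℚₚ.*-inverseʳ q {{≢-nonZero q≢0}}

0<inv : ∀ {q} → 0ℚ < q → 0ℚ < inv q
0<inv {q} 0<q with q ≟ 0ℚ
... | yes q≡0 = ⊥-elim (ℚₚ.<-irrefl (sym q≡0) 0<q)
... | no q≢0  = ℚₚ.positive⁻¹ _ {{ℚₚ.1/pos⇒pos q {{positive 0<q}}}}

-- `ℕ→ℚ` normalises its fraction and does not reduce on variables, so the identity is checked on
-- unnormalised rationals, where it is one about integers.
ℕ→ℚ-+ : ∀ m n → ℕ→ℚ (m +ℕ n) ≡ ℕ→ℚ m + ℕ→ℚ n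
ℕ→ℚ-+ m n = ℚₚ.toℚᵘ-injective (begin
  toℚᵘ (ℕ→ℚ (m +ℕ n))                  ≈⟨ ℚₚ.toℚᵘ-fromℚᵘ (mkℚᵘ (ℤ.+ (m +ℕ n)) 0) ⟩
  mkℚᵘ (ℤ.+ (m +ℕ n)) 0                  ≈⟨ *≡* (cong (ℤ._* ℤ.+ 1) (trans (ℤₚ.pos-+ m n)
                                            (sym (cong₂ ℤ._+_ (ℤₚ.*-identityʳ (ℤ.+ m)) (ℤₚ.*-identityʳ (ℤ.+ n)))))) ⟩
  mkℚᵘ (ℤ.+ m) 0 ℚᵘ.+ mkℚᵘ (ℤ.+ n) 0       ≈⟨ ℚᵘₚ.+-cong (ℚₚ.toℚᵘ-fromℚᵘ (mkℚᵘ (ℤ.+ m) 0)) (ℚₚ.toℚᵘ-fromℚᵘ (mkℚᵘ (ℤ.+ n) 0)) ⟨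
  toℚᵘ (ℕ→ℚ m) ℚᵘ.+ toℚᵘ (ℕ→ℚ n)       ≈⟨ ℚₚ.toℚᵘ-homo-+ (ℕ→ℚ m) (ℕ→ℚ n) ⟨
  toℚᵘ (ℕ→ℚ m + ℕ→ℚ n)                 ∎)
  where open ℚᵘₚ.≃-Reasoning

ℕ→ℚ-* : ∀ m n → ℕ→ℚ (m * n) ≡ ℕ→ℚ m *ℚ ℕ→ℚ n
ℕ→ℚ-* zero    n = sym (ℚₚ.*-zeroˡ (ℕ→ℚ n))
ℕ→ℚ-* (suc m) n = begin
  ℕ→ℚ (n +ℕ m * n)               ≡⟨ ℕ→ℚ-+ n (m * n) ⟩
  ℕ→ℚ n + ℕ→ℚ (m * n)            ≡⟨ cong (ℕ→ℚ n +_) (ℕ→ℚ-* m n) ⟩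
  ℕ→ℚ n + ℕ→ℚ m *ℚ ℕ→ℚ n         ≡⟨ solve 2 (λ x y → x :+ y :* x := (con 1ℚ :+ y) :* x) refl (ℕ→ℚ n) (ℕ→ℚ m) ⟩
  (1ℚ + ℕ→ℚ m) *ℚ ℕ→ℚ n          ≡⟨ cong (_*ℚ ℕ→ℚ n) (ℕ→ℚ-+ 1 m) ⟨
  ℕ→ℚ (suc m) *ℚ ℕ→ℚ n           ∎
  where open ≡-Reasoning; open +-*-Solver

0≤ℕ→ℚ : ∀ n → 0ℚ ≤ ℕ→ℚ n
0≤ℕ→ℚ n = ℚₚ.nonNegative⁻¹ (ℕ→ℚ n) {{ℚₚ.normalize-nonNeg n 1}}

ℕ→ℚ-mono : ∀ {m n} → m ≤ℕ n → ℕ→ℚ m ≤ ℕ→ℚ n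
ℕ→ℚ-mono {m} {n} m≤n = p+d≡q⇒p≤q (ℕ→ℚ (n ∸ m)) (0≤ℕ→ℚ (n ∸ m))
  (trans (sym (ℕ→ℚ-+ m (n ∸ m))) (cong ℕ→ℚ (ℕₚ.m+[n∸m]≡n m≤n)))

ℕ→ℚ-cancel-< : ∀ {m n} → ℕ→ℚ m < ℕ→ℚ n → m <ℕ n
ℕ→ℚ-cancel-< {m} {n} m<n with m ℕₚ.<? n
... | yes m<ℕn = m<ℕn
... | no  m≮n  = ⊥-elim (ℚₚ.<-irrefl refl (ℚₚ.<-≤-trans m<n (ℕ→ℚ-mono (ℕₚ.≮⇒≥ m≮n))))

-- Denominators are at least 1. This turns a rational bound into a number of iterations.
≤-∣numerator∣ : ∀ q → q ≤ ℕ→ℚ ℤ.∣ ↥ q ∣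
≤-∣numerator∣ q@(mkℚ n d-1 _) = ℚₚ.toℚᵘ-cancel-≤
  (ℚᵘₚ.≤-trans (ℚᵘ.*≤* (bound n)) (ℚᵘₚ.≤-reflexive (ℚᵘₚ.≃-sym (ℚₚ.toℚᵘ-fromℚᵘ (mkℚᵘ (ℤ.+ ℤ.∣ n ∣) 0)))))
  where
  bound : ∀ n → n ℤ.* ℤ.+ 1 ℤ.≤ ℤ.+ ℤ.∣ n ∣ ℤ.* ℤ.+ suc d-1
  bound (ℤ.+ n)      = subst₂ ℤ._≤_ (ℤₚ.pos-* n 1) (ℤₚ.pos-* n (suc d-1)) (ℤ.+≤+ (ℕₚ.*-monoʳ-≤ n (s≤s z≤n)))
  bound (ℤ.-[1+ n ]) = ℤ.-≤+

-- The floor of the binary logarithm.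

n≤1+2⌊n/2⌋ : ∀ n → n ≤ℕ suc (2 * ⌊ n /2⌋)
n≤1+2⌊n/2⌋ 0 = z≤n
n≤1+2⌊n/2⌋ 1 = s≤s z≤n
n≤1+2⌊n/2⌋ (suc (suc n)) =
  subst (λ x → suc (suc n) ≤ℕ suc x) (sym (ℕₚ.*-suc 2 ⌊ n /2⌋)) (s≤s (s≤s (n≤1+2⌊n/2⌋ n)))

n<2^[1+⌊log₂n⌋] : ∀ n → n <ℕ 2 ^ suc ⌊log₂ n ⌋
n<2^[1+⌊log₂n⌋] = <-rec _ step
  where
  step : ∀ n → (∀ {m} → m <ℕ n → m <ℕ 2 ^ suc ⌊log₂ m ⌋) → n <ℕ 2 ^ suc ⌊log₂ n ⌋
  step 0 _ = s≤s z≤n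
  step 1 _ = s≤s (s≤s z≤n)
  step n@(suc (suc k)) rec = begin
    suc n                            ≤⟨ s≤s (n≤1+2⌊n/2⌋ n) ⟩
    suc (suc (2 * ⌊ n /2⌋))          ≡⟨ ℕₚ.*-suc 2 ⌊ n /2⌋ ⟨
    2 * suc ⌊ n /2⌋                  ≤⟨ ℕₚ.*-monoʳ-≤ 2 (rec (ℕₚ.⌊n/2⌋<n (suc k))) ⟩
    2 * 2 ^ suc ⌊log₂ ⌊ n /2⌋ ⌋      ≡⟨ cong (λ x → 2 * 2 ^ suc x) (⌊log₂⌊n/2⌋⌋≡⌊log₂n⌋∸1 n) ⟩
    -- The truncated subtraction is exact: `n` is at least 2, so its logarithm is at least 1.
    2 * 2 ^ suc (⌊log₂ n ⌋ ∸ 1)  ≡⟨ cong (λ x → 2 * 2 ^ x) (ℕₚ.m+[n∸m]≡n {1} (⌊log₂⌋-mono-≤ {2} {n} (s≤s (s≤s z≤n)))) ⟩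
    2 ^ suc ⌊log₂ n ⌋                ∎
    where open ℕₚ.≤-Reasoning

-- Finite sums and vectors extended at the end.

private variable t : ℕ

Σ-cong : {f g : Fin t → ℚ} → (∀ i → f i ≡ g i) → Σ f ≡ Σ g
Σ-cong {zero}  f≡g = refl
Σ-cong {suc t} f≡g = cong₂ _+_ (f≡g zero) (Σ-cong (λ i → f≡g (suc i)))

Σ-mono : {f g : Fin t → ℚ} → (∀ i → f i ≤ g i) → Σ f ≤ Σ g
Σ-mono {zero}  f≤g = ℚₚ.≤-refl
Σ-mono {suc t} f≤g = ℚₚ.+-mono-≤ (f≤g zero) (Σ-mono (λ i → f≤g (suc i)))

Σ-linear : (a : ℚ) (f g : Fin t → ℚ) → Σ (λ i → f i + a *ℚ g i) ≡ Σ f + a *ℚ Σ g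
Σ-linear {zero}  a f g = sym (trans (ℚₚ.+-identityˡ _) (ℚₚ.*-zeroʳ a))
Σ-linear {suc t} a f g rewrite Σ-linear a (λ i → f (suc i)) (λ i → g (suc i)) =
  solve 5 (λ a x y z w → (x :+ a :* y) :+ (z :+ a :* w) := (x :+ z) :+ a :* (y :+ w)) refl
    a (f zero) (g zero) (Σ (λ i → f (suc i))) (Σ (λ i → g (suc i)))
  where open +-*-Solver

Σ-* : (a : ℚ) (f : Fin t → ℚ) → Σ (λ i → a *ℚ f i) ≡ a *ℚ Σ f
Σ-* {zero}  a f = sym (ℚₚ.*-zeroʳ a)
Σ-* {suc t} a f rewrite Σ-* a (λ i → f (suc i)) = sym (ℚₚ.*-distribˡ-+ a _ _)

Σ-+ : (f g : Fin t → ℚ) → Σ (λ i → f i + g i) ≡ Σ f + Σ g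
Σ-+ f g = trans (Σ-cong λ i → cong₂ _+_ {f i} refl (sym (ℚₚ.*-identityˡ (g i))))
         (trans (Σ-linear 1ℚ f g) (cong₂ _+_ {Σ f} refl (ℚₚ.*-identityˡ (Σ g))))

Σ-nonneg : {f : Fin t → ℚ} → (∀ i → 0ℚ ≤ f i) → 0ℚ ≤ Σ f
Σ-nonneg {zero}  0≤f = ℚₚ.≤-refl
Σ-nonneg {suc t} 0≤f = 0≤+ (0≤f zero) (Σ-nonneg (λ i → 0≤f (suc i)))

Σ-last : (f : Fin (suc t) → ℚ) → Σ f ≡ Σ (λ i → f (inject₁ i)) + f (fromℕ t)
Σ-last {zero}  f = ℚₚ.+-comm (f zero) 0ℚ
Σ-last {suc t} f = trans (cong₂ _+_ {f zero} refl (Σ-last (λ i → f (suc i)))) (sym (ℚₚ.+-assoc (f zero) _ _))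

-- Recovers the integrality of the number of alive users, which is a rational sum in the problem
-- statement.
Σ-count : (b : Fin t → Bool) → Σ[ k ∈ ℕ ] Σ (λ i → [ b i ]ℚ 1ℚ) ≡ ℕ→ℚ k
Σ-count {zero}  b = 0 , refl
Σ-count {suc t} b with b zero | Σ-count (λ i → b (suc i))
... | true  | k , eq = suc k , trans (cong₂ _+_ {1ℚ} refl eq) (sym (ℕ→ℚ-+ 1 k))
... | false | k , eq = k , trans (cong₂ _+_ {0ℚ} refl eq) (ℚₚ.+-identityˡ _)

lookup-∷ʳ-inject₁ : ∀ {A : Set} (xs : Vec A t) x i → lookup (xs ∷ʳ x) (inject₁ i) ≡ lookup xs i
lookup-∷ʳ-inject₁ (y ∷ xs) x zero    = refl
lookup-∷ʳ-inject₁ (y ∷ xs) x (suc i) = lookup-∷ʳ-inject₁ xs x i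

lookup-∷ʳ-fromℕ : ∀ {A : Set} (xs : Vec A t) x → lookup (xs ∷ʳ x) (fromℕ t) ≡ x
lookup-∷ʳ-fromℕ []       x = refl
lookup-∷ʳ-fromℕ (y ∷ xs) x = lookup-∷ʳ-fromℕ xs x

lookup-init : ∀ {A : Set} (xs : Vec A (suc t)) i → lookup (init xs) i ≡ lookup xs (inject₁ i)
lookup-init xs i with initLast xs
... | ys , y , refl = sym (lookup-∷ʳ-inject₁ ys y i)

-- The logarithmic relation between weight and load.

2^ : ℕ → ℚ
2^ k = ℕ→ℚ (2 ^ k)

2^-suc : ∀ k → 2^ (suc k) ≡ 2^ k + 2^ k
2^-suc k = trans (cong ℕ→ℚ (cong (2 ^ k +ℕ_) (ℕₚ.+-identityʳ (2 ^ k)))) (ℕ→ℚ-+ (2 ^ k) (2 ^ k))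

-- With u = D f + 1, tangent k says y / 2p ≤ k − 1 + u / 2ᵏ, cleared of denominators.  The right-hand
-- sides are the lines of the piecewise linear interpolation of log₂ u, so jointly they state
-- y ≤ 2 p log₂ u (interpolated) in a form that avoids logarithms of rationals.
record Balanced (D p f y : ℚ) : Set where
  field
    nonneg  : 0ℚ ≤ f
    bounded : f ≤ 3ℚ
    tangent : ∀ k → y *ℚ 2^ k + 2ℚ *ℚ p *ℚ 2^ k ≤ 2ℚ *ℚ p *ℚ (ℕ→ℚ k *ℚ 2^ k + (D *ℚ f + 1ℚ))

open Balanced

balanced-0 : ∀ D {p} → 0ℚ ≤ p → Balanced D p 0ℚ 0ℚ
balanced-0 D {p} 0≤p = record
  { nonneg  = ℚₚ.≤-refl
  ; bounded = ℚₚ.nonNegative⁻¹ 3ℚ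
  ; tangent = λ where
      zero    → p+d≡q⇒p≤q 0ℚ ℚₚ.≤-refl
        (solve 2 (λ D p → con 0ℚ :* con 1ℚ :+ two :* p :* con 1ℚ :+ con 0ℚ
                       := two :* p :* (con 0ℚ :* con 1ℚ :+ (D :* con 0ℚ :+ con 1ℚ))) refl D p)
      (suc j) → p+d≡q⇒p≤q (2ℚ *ℚ p *ℚ (ℕ→ℚ j *ℚ 2^ (suc j) + 1ℚ))
        (0≤* (0≤* (ℚₚ.nonNegative⁻¹ 2ℚ) 0≤p) (0≤+ (0≤* (0≤ℕ→ℚ j) (0≤ℕ→ℚ (2 ^ suc j))) 0≤1))
        (trans (solve 4 (λ D p j T → con 0ℚ :* T :+ two :* p :* T :+ two :* p :* (j :* T :+ con 1ℚ)
                       := two :* p :* ((con 1ℚ :+ j) :* T :+ (D :* con 0ℚ :+ con 1ℚ))) refl D p (ℕ→ℚ j) (2^ (suc j)))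
          (cong (λ x → 2ℚ *ℚ p *ℚ (x *ℚ 2^ (suc j) + (D *ℚ 0ℚ + 1ℚ))) (sym (ℕ→ℚ-+ 1 j))))
  }
  where
  open +-*-Solver
  two : ∀ {n} → Polynomial n
  two = con 1ℚ :+ con 1ℚ

module _ {D δ p μ : ℚ} (1≤D : 1ℚ ≤ D) (D*δ≡1 : D *ℚ δ ≡ 1ℚ) (0≤δ : 0ℚ ≤ δ) (δ≤1 : δ ≤ 1ℚ)
         (0<μ : 0ℚ < μ) (μ≤p : μ ≤ p) where
  open +-*-Solver

  private
    0≤D = ℚₚ.≤-trans 0≤1 1≤D
    0≤μ = ℚₚ.<⇒≤ 0<μ
    0<p = ℚₚ.<-≤-trans 0<μ μ≤p
    0≤p = ℚₚ.<⇒≤ 0<p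
    0≤2 = ℚₚ.nonNegative⁻¹ 2ℚ

    two : ∀ {n} → Polynomial n
    two = con 1ℚ :+ con 1ℚ

  -- Dividing the increment by the price makes the money spent on a request independent of its
  -- price.
  *-augmented : ∀ f → p *ℚ (μ *ℚ inv p *ℚ (f + δ)) ≡ μ *ℚ (f + δ)
  *-augmented f = trans
    (solve 4 (λ p μ q x → p :* (μ :* q :* x) := p :* q :* (μ :* x)) refl p μ (inv p) (f + δ))
    (trans (cong (_*ℚ (μ *ℚ (f + δ))) (*-inv 0<p)) (ℚₚ.*-identityˡ _))

  0≤augmentation : ∀ {f} → 0ℚ ≤ f → 0ℚ ≤ μ *ℚ inv p *ℚ (f + δ)
  0≤augmentation 0≤f = 0≤* (0≤* 0≤μ (ℚₚ.<⇒≤ (0<inv 0<p))) (0≤+ 0≤f 0≤δ)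

  augmentation≤2 : ∀ {f} → 0ℚ ≤ f → f ≤ 1ℚ → μ *ℚ inv p *ℚ (f + δ) ≤ 2ℚ
  augmentation≤2 {f} 0≤f f≤1 = begin
    μ *ℚ inv p *ℚ (f + δ)  ≤⟨ *-monoˡ (f + δ) (0≤+ 0≤f 0≤δ) (*-monoˡ (inv p) (ℚₚ.<⇒≤ (0<inv 0<p)) μ≤p) ⟩
    p *ℚ inv p *ℚ (f + δ)  ≡⟨ cong (_*ℚ (f + δ)) (*-inv 0<p) ⟩
    1ℚ *ℚ (f + δ)          ≡⟨ ℚₚ.*-identityˡ (f + δ) ⟩
    f + δ                  ≤⟨ ℚₚ.+-mono-≤ f≤1 δ≤1 ⟩
    2ℚ                     ∎
    where open ≤-Reasoning

  balanced-augment : ∀ {f y} → f < 1ℚ → Balanced D p f y → Balanced D p (f + μ *ℚ inv p *ℚ (f + δ)) (y + μ)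
  balanced-augment {f} {y} f<1 bal = record
    { nonneg  = 0≤+ 0≤f (0≤augmentation 0≤f)
    ; bounded = ℚₚ.+-mono-≤ f≤1 (augmentation≤2 0≤f f≤1)
    ; tangent = tangent′
    }
    where
    0≤f = nonneg bal
    f≤1 = ℚₚ.<⇒≤ f<1
    u f′ : ℚ
    u = D *ℚ f + 1ℚ
    f′ = f + μ *ℚ inv p *ℚ (f + δ)

    1≤u : 1ℚ ≤ u
    1≤u = ℚₚ.+-monoˡ-≤ 1ℚ (0≤* 0≤D 0≤f)

    -- Since `D *ℚ δ ≡ 1ℚ`, `u` equals `D *ℚ (f + δ)`, so the step multiplies `u` by 1 + μ/p. The
    -- right-hand side of every tangent thus gains exactly 2μu, against μ2ᵏ on the left.
    growth : ∀ x → 2ℚ *ℚ p *ℚ (x + u) + 2ℚ *ℚ μ *ℚ u ≡ 2ℚ *ℚ p *ℚ (x + (D *ℚ f′ + 1ℚ))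
    growth x = begin
      2ℚ *ℚ p *ℚ (x + u) + 2ℚ *ℚ μ *ℚ (D *ℚ f + 1ℚ)
        ≡⟨ cong (λ z → 2ℚ *ℚ p *ℚ (x + u) + 2ℚ *ℚ μ *ℚ (D *ℚ f + z)) D*δ≡1 ⟨
      2ℚ *ℚ p *ℚ (x + u) + 2ℚ *ℚ μ *ℚ (D *ℚ f + D *ℚ δ)
        ≡⟨ solve 6 (λ p μ x D f δ → two :* p :* (x :+ (D :* f :+ con 1ℚ)) :+ two :* μ :* (D :* f :+ D :* δ)
              := two :* p :* (x :+ (D :* f :+ con 1ℚ)) :+ two :* D :* (μ :* (f :+ δ))) refl p μ x D f δ ⟩
      2ℚ *ℚ p *ℚ (x + u) + 2ℚ *ℚ D *ℚ (μ *ℚ (f + δ))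
        ≡⟨ cong (λ z → 2ℚ *ℚ p *ℚ (x + u) + 2ℚ *ℚ D *ℚ z) (*-augmented f) ⟨
      2ℚ *ℚ p *ℚ (x + u) + 2ℚ *ℚ D *ℚ (p *ℚ (μ *ℚ inv p *ℚ (f + δ)))
        ≡⟨ solve 5 (λ p x D f g → two :* p :* (x :+ (D :* f :+ con 1ℚ)) :+ two :* D :* (p :* g)
              := two :* p :* (x :+ (D :* (f :+ g) :+ con 1ℚ))) refl p x D f (μ *ℚ inv p *ℚ (f + δ)) ⟩
      2ℚ *ℚ p *ℚ (x + (D *ℚ f′ + 1ℚ)) ∎
      where open ≡-Reasoning

    Tangent : ℚ → ℚ → Set
    Tangent x T = (y + μ) *ℚ T + 2ℚ *ℚ p *ℚ T ≤ 2ℚ *ℚ p *ℚ (x + u) + 2ℚ *ℚ μ *ℚ u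

    -- If 2ᵏ ≤ 2u then the k-th line is steep enough to absorb the step; otherwise (far) the line
    -- for k − 1 lies below it at u and has enough slack.
    near : ∀ x T → y *ℚ T + 2ℚ *ℚ p *ℚ T ≤ 2ℚ *ℚ p *ℚ (x + u) → T ≤ 2ℚ *ℚ u → Tangent x T
    near x T h T≤2u = p+d≡q⇒p≤q _ (0≤+ (p≤q⇒0≤q-p h) (0≤* 0≤μ (p≤q⇒0≤q-p T≤2u)))
      (solve 6 (λ p μ y x u T →
         ((y :+ μ) :* T :+ two :* p :* T)
           :+ ((two :* p :* (x :+ u) :- (y :* T :+ two :* p :* T)) :+ μ :* (two :* u :- T))
         := two :* p :* (x :+ u) :+ two :* μ :* u) refl p μ y x u T)

    far : ∀ j T → y *ℚ T + 2ℚ *ℚ p *ℚ T ≤ 2ℚ *ℚ p *ℚ (j *ℚ T + u) → 0ℚ ≤ T → u ≤ T →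
          Tangent ((1ℚ + j) *ℚ (T + T)) (T + T)
    far j T h 0≤T u≤T = p+d≡q⇒p≤q _
      (0≤+ (0≤* 0≤2 (p≤q⇒0≤q-p h))
        (0≤+ (0≤* 0≤2 (0≤* (p≤q⇒0≤q-p μ≤p) (p≤q⇒0≤q-p u≤T))) (0≤* 0≤2 (0≤* 0≤p 0≤T))))
      (solve 6 (λ p μ y j u T →
         ((y :+ μ) :* (T :+ T) :+ two :* p :* (T :+ T))
           :+ (two :* (two :* p :* (j :* T :+ u) :- (y :* T :+ two :* p :* T))
               :+ (two :* ((p :- μ) :* (T :- u)) :+ two :* (p :* T)))
         := two :* p :* ((con 1ℚ :+ j) :* (T :+ T) :+ u) :+ two :* μ :* u) refl p μ y j u T)

    tangent″ : ∀ k → Tangent (ℕ→ℚ k *ℚ 2^ k) (2^ k)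
    -- The line for `k = 0` has no predecessor, but 2⁰ never exceeds 2u because `u` is at least 1.
    tangent″ zero = near (ℕ→ℚ 0 *ℚ 2^ 0) (2^ 0) (tangent bal 0) (ℚₚ.≤-trans 1≤2 (*-monoʳ 2ℚ 0≤2 1≤u))
      where
      1≤2 : 1ℚ ≤ 2ℚ
      1≤2 = p+d≡q⇒p≤q 1ℚ 0≤1 refl
    tangent″ (suc j) with ℚₚ.≤-total (2^ j) u
    ... | inj₁ T≤u = near (ℕ→ℚ (suc j) *ℚ 2^ (suc j)) (2^ (suc j)) (tangent bal (suc j))
      (subst₂ _≤_ (sym (2^-suc j)) (solve 1 (λ u → u :+ u := two :* u) refl u) (ℚₚ.+-mono-≤ T≤u T≤u))
    ... | inj₂ u≤T = subst₂ (λ a T → Tangent (a *ℚ T) T) (sym (ℕ→ℚ-+ 1 j)) (sym (2^-suc j))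
      (far (ℕ→ℚ j) (2^ j) (tangent bal j) (0≤ℕ→ℚ (2 ^ j)) u≤T)

    tangent′ : ∀ k → (y + μ) *ℚ 2^ k + 2ℚ *ℚ p *ℚ 2^ k ≤ 2ℚ *ℚ p *ℚ (ℕ→ℚ k *ℚ 2^ k + (D *ℚ f′ + 1ℚ))
    tangent′ k = ℚₚ.≤-trans (tangent″ k) (ℚₚ.≤-reflexive (growth (ℕ→ℚ k *ℚ 2^ k)))

-- Take the tangent at `k = suc ℓ`, whose power `T` is at least `D`. As `f` is at most 3, D f + 1 ≤
-- 4D ≤ 4T, and dividing by `T` leaves y ≤ 2p(ℓ + 4).
balanced-load : ∀ c {p f y} → 0ℚ ≤ p → Balanced (ℕ→ℚ (suc c)) p f y → 2ℚ *ℚ y ≤ logBound 16 c *ℚ p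
balanced-load c {p} {f} {y} 0≤p bal = ℚₚ.≤-trans (*-monoʳ 2ℚ 0≤2 y≤)
  -- The constant 16 comes from 4(ℓ + 4) ≤ 16(1 + ℓ), with slack 12ℓ.
  (p+d≡q⇒p≤q (ℕ→ℚ 12 *ℚ (ℕ→ℚ ℓ *ℚ p)) (0≤* (0≤ℕ→ℚ 12) (0≤* (0≤ℕ→ℚ ℓ) 0≤p))
    (trans (solve 2 (λ ℓ p → two :* (two :* p :* (ℓ :+ con 4ℚ)) :+ con (ℕ→ℚ 12) :* (ℓ :* p)
                          := (con (ℕ→ℚ 16) :* (con 1ℚ :+ ℓ)) :* p) refl (ℕ→ℚ ℓ) p)
      (cong (_*ℚ p) (sym (trans (ℕ→ℚ-* 16 (suc ℓ)) (cong (ℕ→ℚ 16 *ℚ_) (ℕ→ℚ-+ 1 ℓ)))))))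
  where
  open +-*-Solver
  two : ∀ {n} → Polynomial n
  two = con 1ℚ :+ con 1ℚ
  0≤2 = ℚₚ.nonNegative⁻¹ 2ℚ
  ℓ = ⌊log₂ c ⌋
  D = ℕ→ℚ (suc c)
  T = 2^ (suc ℓ)

  D≤T : D ≤ T
  D≤T = ℕ→ℚ-mono (n<2^[1+⌊log₂n⌋] c)

  1≤D : 1ℚ ≤ D
  1≤D = ℕ→ℚ-mono {1} {suc c} (s≤s z≤n)

  0<T : 0ℚ < T
  0<T = ℚₚ.<-≤-trans (ℚₚ.positive⁻¹ 1ℚ) (ℚₚ.≤-trans 1≤D D≤T)

  h : y *ℚ T + 2ℚ *ℚ p *ℚ T ≤ 2ℚ *ℚ p *ℚ ((1ℚ + ℕ→ℚ ℓ) *ℚ T + (D *ℚ f + 1ℚ))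
  h = subst (λ k → y *ℚ T + 2ℚ *ℚ p *ℚ T ≤ 2ℚ *ℚ p *ℚ (k *ℚ T + (D *ℚ f + 1ℚ))) (ℕ→ℚ-+ 1 ℓ)
    (tangent bal (suc ℓ))

  y≤ : y ≤ 2ℚ *ℚ p *ℚ (ℕ→ℚ ℓ + 4ℚ)
  y≤ = ℚₚ.*-cancelʳ-≤-pos T {{positive 0<T}} (p+d≡q⇒p≤q _
    (0≤+ (p≤q⇒0≤q-p h) (0≤* (0≤* 0≤2 0≤p)
      (0≤+ (0≤* (ℚₚ.nonNegative⁻¹ 4ℚ) (p≤q⇒0≤q-p D≤T))
        (0≤+ (0≤* (ℚₚ.≤-trans 0≤1 1≤D) (p≤q⇒0≤q-p (bounded bal))) (p≤q⇒0≤q-p 1≤D)))))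
    (solve 6 (λ y p ℓ T D f →
       y :* T :+ ((two :* p :* ((con 1ℚ :+ ℓ) :* T :+ (D :* f :+ con 1ℚ)) :- (y :* T :+ two :* p :* T))
                  :+ two :* p :* (con 4ℚ :* (T :- D) :+ (D :* (con 3ℚ :- f) :+ (D :- con 1ℚ))))
       := two :* p :* (ℓ :+ con 4ℚ) :* T) refl y p (ℕ→ℚ ℓ) T D f))

-- The charge made on an overloaded edge.

[]ℚ-nonneg : ∀ b {q} → 0ℚ ≤ q → 0ℚ ≤ [ b ]ℚ q
[]ℚ-nonneg true  0≤q = 0≤q
[]ℚ-nonneg false 0≤q = ℚₚ.≤-refl

-- Integrality sharpens c < k to c + 1 ≤ k, which is what gives k ≤ D (k − c).
overload-charge : ∀ {D δ F} k c → D *ℚ δ ≡ 1ℚ → 0ℚ ≤ δ → ℕ→ℚ (suc c) ≤ D → 0ℚ ≤ F → F < ℕ→ℚ k - ℕ→ℚ c →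
  (F + δ *ℚ ℕ→ℚ k ≤ 2ℚ *ℚ (ℕ→ℚ k - ℕ→ℚ c)) × (δ ≤ F + δ *ℚ ℕ→ℚ k)
overload-charge {D} {δ} {F} k c D*δ≡1 0≤δ c<D 0≤F F<k-c = upper , lower
  where
  open +-*-Solver
  x = ℕ→ℚ k
  z = ℕ→ℚ c

  c<k : suc c ≤ℕ k
  c<k = ℕ→ℚ-cancel-< (ℚₚ.<-respˡ-≡ (ℚₚ.+-identityˡ z) (ℚₚ.<-respʳ-≡
    (solve 2 (λ x z → x :- z :+ z := x) refl x z)
    (ℚₚ.+-monoˡ-< z (ℚₚ.≤-<-trans 0≤F F<k-c))))

  1+z≤x : 1ℚ + z ≤ x
  1+z≤x = subst (_≤ x) (ℕ→ℚ-+ 1 c) (ℕ→ℚ-mono c<k)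

  1+z≤D : 1ℚ + z ≤ D
  1+z≤D = subst (_≤ D) (ℕ→ℚ-+ 1 c) c<D

  0≤z = 0≤ℕ→ℚ c

  0≤x-z : 0ℚ ≤ x - z
  0≤x-z = ℚₚ.≤-trans 0≤F (ℚₚ.<⇒≤ F<k-c)

  x≤D[x-z] : x ≤ D *ℚ (x - z)
  x≤D[x-z] = p+d≡q⇒p≤q _ (0≤+ (0≤* (p≤q⇒0≤q-p 1+z≤D) 0≤x-z) (0≤* 0≤z (p≤q⇒0≤q-p 1+z≤x)))
    (solve 3 (λ x z D → x :+ ((D :- (con 1ℚ :+ z)) :* (x :- z) :+ z :* (x :- (con 1ℚ :+ z)))
                     := D :* (x :- z)) refl x z D)

  upper : F + δ *ℚ x ≤ 2ℚ *ℚ (x - z)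
  upper = begin
    F + δ *ℚ x                           ≤⟨ ℚₚ.+-mono-≤ (ℚₚ.<⇒≤ F<k-c) (*-monoʳ δ 0≤δ x≤D[x-z]) ⟩
    (x - z) + δ *ℚ (D *ℚ (x - z))        ≡⟨ solve 3 (λ w δ D → w :+ δ :* (D :* w) := (con 1ℚ :+ D :* δ) :* w) refl (x - z) δ D ⟩
    (1ℚ + D *ℚ δ) *ℚ (x - z)             ≡⟨ cong (λ q → (1ℚ + q) *ℚ (x - z)) D*δ≡1 ⟩
    2ℚ *ℚ (x - z)                        ∎
    where open ≤-Reasoning

  lower : δ ≤ F + δ *ℚ x
  -- An overloaded edge has at least one alive user, and its `δ` suffices even when all weights are
  -- still zero.
  lower = p+d≡q⇒p≤q _ (0≤+ 0≤F (0≤* 0≤δ (0≤+ (p≤q⇒0≤q-p 1+z≤x) 0≤z)))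
    (solve 4 (λ F δ x z → δ :+ (F :+ δ :* (x :- (con 1ℚ :+ z) :+ z)) := F :+ δ :* x) refl F δ x z)

-- Maximum capacity and iteration counts.

cap≤maxCap : ∀ {n} (f : Fin n → ℕ) i → f i ≤ℕ foldr _ _⊔_ 0 (tabulate f)
cap≤maxCap f zero    = ℕₚ.m≤m⊔n _ _
cap≤maxCap f (suc i) = ℕₚ.≤-trans (cap≤maxCap (λ j → f (suc j)) i) (ℕₚ.m≤n⊔m (f zero) _)

-- Lets a bound in log c imply one in log(mc). For `n = 0` the maximum is itself 0.
max≤n*max : ∀ n (f : Fin n → ℕ) → foldr _ _⊔_ 0 (tabulate f) ≤ℕ n * foldr _ _⊔_ 0 (tabulate f)
max≤n*max zero    f = z≤n
max≤n*max (suc n) f = ℕₚ.m≤m+n _ _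

repeat : {A : Set} → ℕ → (A → A) → A → A
repeat zero    f x = x
repeat (suc n) f x = f (repeat n f x)

exceeding : ℚ → ℚ → ℕ
exceeding q r = suc ℤ.∣ ↥ (q *ℚ inv r) ∣

<exceeding : ∀ q {r} → 0ℚ < r → q < ℕ→ℚ (exceeding q r) *ℚ r
<exceeding q {r} 0<r = begin-strict
  q                             ≡⟨ ℚₚ.*-identityʳ q ⟨
  q *ℚ 1ℚ                       ≡⟨ cong (q *ℚ_) (*-inv 0<r) ⟨
  q *ℚ (r *ℚ inv r)             ≡⟨ solve 3 (λ q r s → q :* (r :* s) := q :* s :* r) refl q r (inv r) ⟩
  q *ℚ inv r *ℚ r               ≤⟨ *-monoˡ r (ℚₚ.<⇒≤ 0<r) (≤-∣numerator∣ (q *ℚ inv r)) ⟩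
  ℕ→ℚ N *ℚ r                    ≡⟨ ℚₚ.+-identityˡ (ℕ→ℚ N *ℚ r) ⟨
  0ℚ + ℕ→ℚ N *ℚ r               <⟨ ℚₚ.+-monoˡ-< (ℕ→ℚ N *ℚ r) 0<r ⟩
  r + ℕ→ℚ N *ℚ r                ≡⟨ solve 2 (λ r n → r :+ n :* r := (con 1ℚ :+ n) :* r) refl r (ℕ→ℚ N) ⟩
  (1ℚ + ℕ→ℚ N) *ℚ r             ≡⟨ cong (_*ℚ r) (ℕ→ℚ-+ 1 N) ⟨
  ℕ→ℚ (exceeding q r) *ℚ r      ∎
  where
  open ≤-Reasoning
  open +-*-Solver
  N = ℤ.∣ ↥ (q *ℚ inv r) ∣

module _ (G : Graph) where

  -- The algorithm.

  D δ : ℚ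
  D = ℕ→ℚ (suc (maxCap G))
  δ = inv D

  1≤D : 1ℚ ≤ D
  1≤D = ℕ→ℚ-mono {1} {suc (maxCap G)} (s≤s z≤n)

  0<D : 0ℚ < D
  0<D = ℚₚ.<-≤-trans (ℚₚ.positive⁻¹ 1ℚ) 1≤D

  D*δ≡1 : D *ℚ δ ≡ 1ℚ
  D*δ≡1 = *-inv 0<D

  0<δ : 0ℚ < δ
  0<δ = 0<inv 0<D

  0≤δ : 0ℚ ≤ δ
  0≤δ = ℚₚ.<⇒≤ 0<δ

  δ≤1 : δ ≤ 1ℚ
  δ≤1 = subst₂ _≤_ (ℚₚ.*-identityˡ δ) D*δ≡1 (*-monoˡ δ 0≤δ 1≤D)

  -- The step size μ. Starting the fold at `1ℚ` keeps it positive on the empty sequence; the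
  -- analysis uses only that it is positive and at most every price.
  minPrice : Vec (Request G) t → ℚ
  minPrice = foldr _ (λ r q → price r ⊓ q) 1ℚ

  minPrice≤price : (rs : Vec (Request G) t) (i : Fin t) → minPrice rs ≤ price (lookup rs i)
  minPrice≤price (r ∷ rs) zero    = ℚₚ.p⊓q≤p (price r) (minPrice rs)
  minPrice≤price (r ∷ rs) (suc i) = ℚₚ.≤-trans (ℚₚ.p⊓q≤q (price r) (minPrice rs)) (minPrice≤price rs i)

  0<minPrice : (rs : Vec (Request G) t) → ValidSeq G rs → 0ℚ < minPrice rs
  0<minPrice []       valid = ℚₚ.positive⁻¹ 1ℚ
  0<minPrice (r ∷ rs) valid with ℚₚ.⊓-sel (price r) (minPrice rs)
  ... | inj₁ eq = subst (0ℚ <_) (sym eq) (proj₂ (valid zero))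
  ... | inj₂ eq = subst (0ℚ <_) (sym eq) (0<minPrice rs (λ i → valid (suc i)))

  aliveUser : Vec (Request G) t → Vec ℚ t → Fin (m G) → Fin t → Bool
  aliveUser rs f e i = uses e (lookup rs i) ∧ alive (lookup f i)

  aliveCount aliveWeight : Vec (Request G) t → Vec ℚ t → Fin (m G) → ℚ
  aliveCount  rs f e = Σ (λ i → [ aliveUser rs f e i ]ℚ 1ℚ)
  aliveWeight rs f e = Σ (λ i → [ aliveUser rs f e i ]ℚ (lookup f i))

  increment : Vec (Request G) t → Vec ℚ t → Fin t → ℚ
  increment rs f i = minPrice rs *ℚ inv (price (lookup rs i)) *ℚ (lookup f i + δ)

  raise : Vec (Request G) t → Fin (m G) → Vec ℚ t → Vec ℚ t
  raise rs e f = tabulate (λ i → lookup f i + [ aliveUser rs f e i ]ℚ (increment rs f i))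

  Overloaded : Vec (Request G) t → Vec ℚ t → Fin (m G) → Set
  Overloaded rs f e = aliveWeight rs f e < aliveCount rs f e - ℕ→ℚ (cap G e)

  overloaded? : (rs : Vec (Request G) t) (f : Vec ℚ t) → Dec (∃ (Overloaded rs f))
  overloaded? rs f = any? (λ e → aliveWeight rs f e <? aliveCount rs f e - ℕ→ℚ (cap G e))

  -- The decision is an argument so that proofs can split on an arbitrary one.
  augmentIf : (rs : Vec (Request G) t) (f : Vec ℚ t) → Dec (∃ (Overloaded rs f)) → Vec ℚ t
  augmentIf rs f (yes (e , _)) = raise rs e f
  augmentIf rs f (no _)        = f

  augment : Vec (Request G) t → Vec ℚ t → Vec ℚ t
  augment rs f = augmentIf rs f (overloaded? rs f)

  -- Each augmentation raises Σ p_i f_i by at least μ δ, and it never exceeds Σ 3 p_i.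
  fuel : Vec (Request G) t → ℕ
  fuel rs = exceeding (Σ (λ i → 3ℚ *ℚ price (lookup rs i))) (minPrice rs *ℚ δ)

  saturate : Vec (Request G) t → Vec ℚ t → Vec ℚ t
  saturate rs = repeat (fuel rs) (augment rs)

  -- Recursion on the prefix makes the algorithm online: saturation starts from the weights held
  -- before the arrival, with weight 0 for the newcomer.
  run : Vec (Request G) t → Vec ℚ t
  run {zero}  rs = []
  run {suc t} rs = saturate rs (run (init rs) ∷ʳ 0ℚ)

  -- The invariant and the offline demand on alive users.

  spent : Vec (Request G) t → Vec ℚ t → ℚ
  spent rs f = Σ (λ i → price (lookup rs i) *ℚ lookup f i)

  -- load exists only for the analysis; the algorithm never computes it.
  record Invariant (rs : Vec (Request G) t) (f : Vec ℚ t) : Set where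
    field
      load     : Vec ℚ t
      balanced : ∀ i → Balanced D (price (lookup rs i)) (lookup f i) (lookup load i)
      paid     : ∀ f* → OfflineFeasible G rs f* → spent rs f ≤ 2ℚ *ℚ Σ (λ i → lookup f* i *ℚ lookup load i)

  open Invariant

  -- Discarding a user that is no longer alive lowers the demand by 1 and the offline coverage by at
  -- most 1, because `f*` is at most 1.
  offline-residual : (rs : Vec (Request G) t) (f* f : Vec ℚ t) → OfflineFeasible G rs f* → ∀ e →
    aliveCount rs f e - ℕ→ℚ (cap G e) ≤ Σ (λ i → [ aliveUser rs f e i ]ℚ (lookup f* i))
  offline-residual {t} rs f* f (f*-range , covered) e = p+d≡q⇒p≤q _
    (0≤+ (p≤q⇒0≤q-p (covered e)) (p≤q⇒0≤q-p exchange))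
    (solve 5 (λ a c b s r → (a :- c) :+ ((s :- (b :- c)) :+ ((r :+ b) :- (a :+ s))) := r) refl
      (aliveCount rs f e) (ℕ→ℚ (cap G e)) (Σ used) (Σ used*) (Σ alive*))
    where
    open +-*-Solver
    used used* alive* : Fin t → ℚ
    used   i = [ uses e (lookup rs i) ]ℚ 1ℚ
    used*  i = [ uses e (lookup rs i) ]ℚ (lookup f* i)
    alive* i = [ aliveUser rs f e i ]ℚ (lookup f* i)

    pointwise : ∀ a b {q} → q ≤ 1ℚ → [ a ∧ b ]ℚ 1ℚ + [ a ]ℚ q ≤ [ a ∧ b ]ℚ q + [ a ]ℚ 1ℚ
    pointwise true  true  {q} q≤1 = ℚₚ.≤-reflexive (ℚₚ.+-comm 1ℚ q)
    pointwise true  false q≤1 = ℚₚ.+-monoʳ-≤ 0ℚ q≤1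
    pointwise false b     q≤1 = ℚₚ.≤-refl

    exchange : aliveCount rs f e + Σ used* ≤ Σ alive* + Σ used
    exchange = subst₂ _≤_ (Σ-+ (λ i → [ aliveUser rs f e i ]ℚ 1ℚ) used*) (Σ-+ alive* used)
      (Σ-mono (λ i → pointwise (uses e (lookup rs i)) (alive (lookup f i)) (proj₂ (f*-range i))))

  -- One augmentation step.

  module _ {t} (rs : Vec (Request G) t) (valid : ValidSeq G rs) where
    open +-*-Solver

    private
      μ = minPrice rs
      0<μ = 0<minPrice rs valid
      0≤μ = ℚₚ.<⇒≤ 0<μ

    0≤price : ∀ i → 0ℚ ≤ price (lookup rs i)
    0≤price i = ℚₚ.<⇒≤ (proj₂ (valid i))

    -- Iterations left over once feasibility is reached change nothing.
    augment-fixed : ∀ f → OnlineFeasible G rs f → augment rs f ≡ f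
    augment-fixed f feasible = go (overloaded? rs f)
      where
      go : ∀ d → augmentIf rs f d ≡ f
      go (yes (e , overloaded)) = ⊥-elim (ℚₚ.<-irrefl refl (ℚₚ.<-≤-trans overloaded (feasible e)))
      go (no _)                 = refl

    module _ (f : Vec ℚ t) (inv-f : Invariant rs f) where

      private
        0≤f : ∀ i → 0ℚ ≤ lookup f i
        0≤f i = nonneg (balanced inv-f i)

      spent-raise : ∀ e → spent rs (raise rs e f) ≡ spent rs f + μ *ℚ (aliveWeight rs f e + δ *ℚ aliveCount rs f e)
      spent-raise e = begin
        spent rs (raise rs e f)
          ≡⟨ Σ-cong pointwise ⟩
        Σ (λ i → price (lookup rs i) *ℚ lookup f i + μ *ℚ (weight i + δ *ℚ count i))
          ≡⟨ Σ-linear μ (λ i → price (lookup rs i) *ℚ lookup f i) (λ i → weight i + δ *ℚ count i) ⟩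
        spent rs f + μ *ℚ Σ (λ i → weight i + δ *ℚ count i)
          ≡⟨ cong (λ x → spent rs f + μ *ℚ x) (Σ-linear δ weight count) ⟩
        spent rs f + μ *ℚ (aliveWeight rs f e + δ *ℚ aliveCount rs f e) ∎
        where
        open ≡-Reasoning
        count weight : Fin t → ℚ
        count  i = [ aliveUser rs f e i ]ℚ 1ℚ
        weight i = [ aliveUser rs f e i ]ℚ (lookup f i)

        distribute : ∀ b p q x g → p *ℚ g ≡ q *ℚ (x + δ) →
          p *ℚ (x + [ b ]ℚ g) ≡ p *ℚ x + q *ℚ ([ b ]ℚ x + δ *ℚ [ b ]ℚ 1ℚ)
        distribute true p q x g eq = trans (ℚₚ.*-distribˡ-+ p x g)
          (cong₂ _+_ {p *ℚ x} refl (trans eq (cong (λ d → q *ℚ (x + d)) (sym (ℚₚ.*-identityʳ δ)))))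
        distribute false p q x g _ =
          solve 4 (λ p q x d → p :* (x :+ con 0ℚ) := p :* x :+ q :* (con 0ℚ :+ d :* con 0ℚ)) refl p q x δ

        pointwise : ∀ i → price (lookup rs i) *ℚ lookup (raise rs e f) i
                        ≡ price (lookup rs i) *ℚ lookup f i + μ *ℚ (weight i + δ *ℚ count i)
        pointwise i = trans (cong (price (lookup rs i) *ℚ_) (lookup∘tabulate _ i))
          (distribute (aliveUser rs f e i) (price (lookup rs i)) μ (lookup f i) (increment rs f i)
            (*-augmented 1≤D D*δ≡1 0≤δ δ≤1 0<μ (minPrice≤price rs i) (lookup f i)))

      raise-charge : ∀ e → Overloaded rs f e →
        (aliveWeight rs f e + δ *ℚ aliveCount rs f e ≤ 2ℚ *ℚ (aliveCount rs f e - ℕ→ℚ (cap G e)))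
        × (δ ≤ aliveWeight rs f e + δ *ℚ aliveCount rs f e)
      raise-charge e = charge (Σ-count (aliveUser rs f e))
        where
        F = aliveWeight rs f e
        z = ℕ→ℚ (cap G e)
        charge : ∀ {a} → Σ[ k ∈ ℕ ] a ≡ ℕ→ℚ k → F < a - z → (F + δ *ℚ a ≤ 2ℚ *ℚ (a - z)) × (δ ≤ F + δ *ℚ a)
        -- `D` is defined from the largest capacity, so the same `δ` serves every edge.
        charge (k , refl) = overload-charge k (cap G e) D*δ≡1 0≤δ (ℕ→ℚ-mono (s≤s (cap≤maxCap (cap G) e)))
          (Σ-nonneg (λ i → []ℚ-nonneg (aliveUser rs f e i) (0≤f i)))

      raise-increasing : ∀ e i → lookup f i ≤ lookup (raise rs e f) i
      raise-increasing e i = p+d≡q⇒p≤q _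
        ([]ℚ-nonneg (aliveUser rs f e i)
          (0≤augmentation 1≤D D*δ≡1 0≤δ δ≤1 0<μ (minPrice≤price rs i) (0≤f i)))
        (sym (lookup∘tabulate _ i))

      raise-invariant : ∀ e → Overloaded rs f e → Invariant rs (raise rs e f)
      raise-invariant e overloaded = record { load = load′ ; balanced = balanced′ ; paid = paid′ }
        where
        load′ : Vec ℚ t
        load′ = tabulate (λ i → lookup (load inv-f) i + [ aliveUser rs f e i ]ℚ μ)

        -- With the decision behind `alive` abstracted as `d`, the case `yes` supplies the `x < 1ℚ`
        -- that `balanced-augment` needs. In the other cases weight and load both stay put.
        step : ∀ b {p x y} → μ ≤ p → Balanced D p x y → (d : Dec (x < 1ℚ)) →
          Balanced D p (x + [ b ∧ ⌊ d ⌋ ]ℚ (μ *ℚ inv p *ℚ (x + δ))) (y + [ b ∧ ⌊ d ⌋ ]ℚ μ)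
        step true  μ≤p bal (yes x<1) = balanced-augment 1≤D D*δ≡1 0≤δ δ≤1 0<μ μ≤p x<1 bal
        step true  {p} {x} {y} μ≤p bal (no _) =
          subst₂ (Balanced D p) (sym (ℚₚ.+-identityʳ x)) (sym (ℚₚ.+-identityʳ y)) bal
        step false {p} {x} {y} μ≤p bal _ =
          subst₂ (Balanced D p) (sym (ℚₚ.+-identityʳ x)) (sym (ℚₚ.+-identityʳ y)) bal

        balanced′ : ∀ i → Balanced D (price (lookup rs i)) (lookup (raise rs e f) i) (lookup load′ i)
        balanced′ i = subst₂ (Balanced D (price (lookup rs i))) (sym (lookup∘tabulate _ i)) (sym (lookup∘tabulate _ i))
          (step (uses e (lookup rs i)) (minPrice≤price rs i) (balanced inv-f i) (lookup f i <? 1ℚ))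

        module _ (f* : Vec ℚ t) where
          alive* : Fin t → ℚ
          alive* i = [ aliveUser rs f e i ]ℚ (lookup f* i)

          distribute : ∀ b x y → x *ℚ y + μ *ℚ [ b ]ℚ x ≡ x *ℚ (y + [ b ]ℚ μ)
          distribute true  x y = solve 3 (λ x y q → x :* y :+ q :* x := x :* (y :+ q)) refl x y μ
          distribute false x y = solve 3 (λ x y q → x :* y :+ q :* con 0ℚ := x :* (y :+ con 0ℚ)) refl x y μ

          Σ-load′ : Σ (λ i → lookup f* i *ℚ lookup (load inv-f) i) + μ *ℚ Σ alive* ≡ Σ (λ i → lookup f* i *ℚ lookup load′ i)
          Σ-load′ = trans (sym (Σ-linear μ (λ i → lookup f* i *ℚ lookup (load inv-f) i) alive*))
            (Σ-cong (λ i → trans (distribute (aliveUser rs f e i) (lookup f* i) (lookup (load inv-f) i))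
                                 (cong (lookup f* i *ℚ_) (sym (lookup∘tabulate _ i)))))

        paid′ : ∀ f* → OfflineFeasible G rs f* → spent rs (raise rs e f) ≤ 2ℚ *ℚ Σ (λ i → lookup f* i *ℚ lookup load′ i)
        paid′ f* feasible = begin
          spent rs (raise rs e f)
            ≡⟨ spent-raise e ⟩
          spent rs f + μ *ℚ (aliveWeight rs f e + δ *ℚ aliveCount rs f e)
            -- The new spending is at most 2μ times the excess of the edge, and any offline solution
            -- places at least that excess on the alive users.
            ≤⟨ ℚₚ.+-mono-≤ (paid inv-f f* feasible) (*-monoʳ μ 0≤μ (ℚₚ.≤-trans (proj₁ (raise-charge e overloaded))
                 (*-monoʳ 2ℚ (ℚₚ.nonNegative⁻¹ 2ℚ) (offline-residual rs f* f feasible e)))) ⟩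
          2ℚ *ℚ S + μ *ℚ (2ℚ *ℚ Σ (alive* f*))
            ≡⟨ solve 4 (λ c s q r → c :* s :+ q :* (c :* r) := c :* (s :+ q :* r)) refl 2ℚ S μ (Σ (alive* f*)) ⟩
          2ℚ *ℚ (S + μ *ℚ Σ (alive* f*))
            ≡⟨ cong (2ℚ *ℚ_) (Σ-load′ f*) ⟩
          2ℚ *ℚ Σ (λ i → lookup f* i *ℚ lookup load′ i) ∎
          where
          open ≤-Reasoning
          S = Σ (λ i → lookup f* i *ℚ lookup (load inv-f) i)

      augment-correct : Invariant rs (augment rs f) × (∀ i → lookup f i ≤ lookup (augment rs f) i)
      augment-correct = go (overloaded? rs f)
        where
        go : ∀ d → Invariant rs (augmentIf rs f d) × (∀ i → lookup f i ≤ lookup (augmentIf rs f d) i)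
        go (yes (e , overloaded)) = raise-invariant e overloaded , raise-increasing e
        go (no _)                 = inv-f , λ _ → ℚₚ.≤-refl

      augment-progress : OnlineFeasible G rs f ⊎ (spent rs f + μ *ℚ δ ≤ spent rs (augment rs f))
      augment-progress = go (overloaded? rs f)
        where
        go : ∀ d → OnlineFeasible G rs f ⊎ (spent rs f + μ *ℚ δ ≤ spent rs (augmentIf rs f d))
        go (yes (e , overloaded)) = inj₂ (ℚₚ.≤-trans
          (ℚₚ.+-monoʳ-≤ (spent rs f) (*-monoʳ μ 0≤μ (proj₂ (raise-charge e overloaded))))
          (ℚₚ.≤-reflexive (sym (spent-raise e))))
        go (no fine) = inj₁ (λ e → ℚₚ.≮⇒≥ (λ overloaded → fine (e , overloaded)))

      spent-bounded : spent rs f ≤ Σ (λ i → 3ℚ *ℚ price (lookup rs i))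
      spent-bounded = Σ-mono (λ i → ℚₚ.≤-trans (*-monoʳ (price (lookup rs i)) (0≤price i) (bounded (balanced inv-f i)))
        (ℚₚ.≤-reflexive (ℚₚ.*-comm (price (lookup rs i)) 3ℚ)))

      spent-nonneg : 0ℚ ≤ spent rs f
      spent-nonneg = Σ-nonneg (λ i → 0≤* (0≤price i) (0≤f i))

    -- Iteration until feasibility.

    repeat-correct : ∀ f → Invariant rs f → ∀ n → let g = repeat n (augment rs) f in
      Invariant rs g × (∀ i → lookup f i ≤ lookup g i)
    repeat-correct f inv-f zero    = inv-f , λ _ → ℚₚ.≤-refl
    repeat-correct f inv-f (suc n) = proj₁ next , λ i → ℚₚ.≤-trans (proj₂ prev i) (proj₂ next i)
      where
      g = repeat n (augment rs) f
      prev = repeat-correct f inv-f n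
      next = augment-correct g (proj₁ prev)

    -- Either feasibility was reached, and then persists, or every iteration so far spent at least
    -- μδ. Spending is bounded, so enough iterations rule out the second case.
    repeat-progress : ∀ f → Invariant rs f → ∀ n → let g = repeat n (augment rs) f in
      OnlineFeasible G rs g ⊎ (ℕ→ℚ n *ℚ (μ *ℚ δ) ≤ spent rs g)
    repeat-progress f inv-f zero = inj₂ (ℚₚ.≤-trans (ℚₚ.≤-reflexive (ℚₚ.*-zeroˡ (μ *ℚ δ))) (spent-nonneg f inv-f))
    repeat-progress f inv-f (suc n) = [ inj₁ ∘ persist , continue ]′ (repeat-progress f inv-f n)
      where
      g = repeat n (augment rs) f

      persist : OnlineFeasible G rs g → OnlineFeasible G rs (augment rs g)
      persist feasible = subst (OnlineFeasible G rs) (sym (augment-fixed g feasible)) feasible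

      accumulate : ℕ→ℚ n *ℚ (μ *ℚ δ) ≤ spent rs g → spent rs g + μ *ℚ δ ≤ spent rs (augment rs g) →
        ℕ→ℚ (suc n) *ℚ (μ *ℚ δ) ≤ spent rs (augment rs g)
      accumulate lower progress = begin
        ℕ→ℚ (suc n) *ℚ (μ *ℚ δ)        ≡⟨ cong (_*ℚ (μ *ℚ δ)) (ℕ→ℚ-+ 1 n) ⟩
        (1ℚ + ℕ→ℚ n) *ℚ (μ *ℚ δ)       ≡⟨ solve 2 (λ k x → (con 1ℚ :+ k) :* x := k :* x :+ x) refl (ℕ→ℚ n) (μ *ℚ δ) ⟩
        ℕ→ℚ n *ℚ (μ *ℚ δ) + μ *ℚ δ     ≤⟨ ℚₚ.+-monoˡ-≤ (μ *ℚ δ) lower ⟩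
        spent rs g + μ *ℚ δ            ≤⟨ progress ⟩
        spent rs (augment rs g)        ∎
        where open ≤-Reasoning

      continue : ℕ→ℚ n *ℚ (μ *ℚ δ) ≤ spent rs g →
        OnlineFeasible G rs (augment rs g) ⊎ (ℕ→ℚ (suc n) *ℚ (μ *ℚ δ) ≤ spent rs (augment rs g))
      continue lower = Sum.map persist (accumulate lower)
        (augment-progress g (proj₁ (repeat-correct f inv-f n)))

    repeat-feasible : ∀ f → Invariant rs f → ∀ n → Σ (λ i → 3ℚ *ℚ price (lookup rs i)) < ℕ→ℚ n *ℚ (μ *ℚ δ) →
      OnlineFeasible G rs (repeat n (augment rs) f)
    repeat-feasible f inv-f n limit = [ id , ⊥-elim ∘ impossible ]′ (repeat-progress f inv-f n)
      where
      g = repeat n (augment rs) f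
      impossible : ¬ (ℕ→ℚ n *ℚ (μ *ℚ δ) ≤ spent rs g)
      impossible lower = ℚₚ.<-irrefl refl (ℚₚ.<-≤-trans limit
        (ℚₚ.≤-trans lower (spent-bounded g (proj₁ (repeat-correct f inv-f n)))))

    saturate-feasible : ∀ f → Invariant rs f → OnlineFeasible G rs (saturate rs f)
    saturate-feasible f inv-f = repeat-feasible f inv-f (fuel rs)
      (<exceeding (Σ (λ i → 3ℚ *ℚ price (lookup rs i))) (0<* 0<μ 0<δ))

    saturate-correct : ∀ f → Invariant rs f → Invariant rs (saturate rs f) × (∀ i → lookup f i ≤ lookup (saturate rs f) i)
    saturate-correct f inv-f = repeat-correct f inv-f (fuel rs)

  -- Arrival of a new request.

  init-valid : (rs : Vec (Request G) (suc t)) → ValidSeq G rs → ValidSeq G (init rs)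
  init-valid rs valid i = subst (ValidRequest G) (sym (lookup-init rs i)) (valid (inject₁ i))

  -- On each edge of its path the last request accounts for 1 unit of demand and at most 1 unit of
  -- coverage, so dropping it preserves feasibility.
  init-offline : (rs : Vec (Request G) (suc t)) (f* : Vec ℚ (suc t)) →
    OfflineFeasible G rs f* → OfflineFeasible G (init rs) (init f*)
  init-offline {t} rs f* (f*-range , covered) =
    (λ i → subst (λ q → (0ℚ ≤ q) × (q ≤ 1ℚ)) (sym (lookup-init f* i)) (f*-range (inject₁ i))) ,
    λ e → drop-last (uses e (lookup rs (fromℕ t)))
      (Σ (λ i → [ uses e (lookup (init rs) i) ]ℚ 1ℚ)) (Σ (λ i → [ uses e (lookup (init rs) i) ]ℚ (lookup (init f*) i)))
      (ℕ→ℚ (cap G e)) (lookup f* (fromℕ t)) (proj₂ (f*-range (fromℕ t)))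
      (subst₂ (λ a b → a - ℕ→ℚ (cap G e) ≤ b) (Σ-count-init e) (Σ-weight-init e) (covered e))
    where
    open +-*-Solver

    Σ-count-init : ∀ e → Σ (λ i → [ uses e (lookup rs i) ]ℚ 1ℚ) ≡
      Σ (λ i → [ uses e (lookup (init rs) i) ]ℚ 1ℚ) + [ uses e (lookup rs (fromℕ t)) ]ℚ 1ℚ
    Σ-count-init e = trans (Σ-last (λ i → [ uses e (lookup rs i) ]ℚ 1ℚ))
      (cong (_+ [ uses e (lookup rs (fromℕ t)) ]ℚ 1ℚ)
        (Σ-cong (λ i → cong (λ r → [ uses e r ]ℚ 1ℚ) (sym (lookup-init rs i)))))

    Σ-weight-init : ∀ e → Σ (λ i → [ uses e (lookup rs i) ]ℚ (lookup f* i)) ≡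
      Σ (λ i → [ uses e (lookup (init rs) i) ]ℚ (lookup (init f*) i)) + [ uses e (lookup rs (fromℕ t)) ]ℚ (lookup f* (fromℕ t))
    Σ-weight-init e = trans (Σ-last (λ i → [ uses e (lookup rs i) ]ℚ (lookup f* i)))
      (cong (_+ [ uses e (lookup rs (fromℕ t)) ]ℚ (lookup f* (fromℕ t)))
        (Σ-cong (λ i → cong₂ (λ r q → [ uses e r ]ℚ q) (sym (lookup-init rs i)) (sym (lookup-init f* i)))))

    drop-last : ∀ b a s c q → q ≤ 1ℚ → (a + [ b ]ℚ 1ℚ) - c ≤ s + [ b ]ℚ q → a - c ≤ s
    drop-last true a s c q q≤1 h = p+d≡q⇒p≤q _ (0≤+ (p≤q⇒0≤q-p h) (p≤q⇒0≤q-p q≤1))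
      (solve 4 (λ a s c q → (a :- c) :+ ((s :+ q :- (a :+ con 1ℚ :- c)) :+ (con 1ℚ :- q)) := s) refl a s c q)
    drop-last false a s c q _ h = subst₂ (λ x y → x - c ≤ y) (ℚₚ.+-identityʳ a) (ℚₚ.+-identityʳ s) h

  -- A newcomer with zero weight and zero load adds nothing to either side of `paid`. The invariant
  -- does not mention μ, so it survives a fall of `minPrice` on arrival.
  invariant-∷ʳ : (rs : Vec (Request G) (suc t)) → ValidSeq G rs → (f : Vec ℚ t) →
    Invariant (init rs) f → Invariant rs (f ∷ʳ 0ℚ)
  invariant-∷ʳ {t} rs valid f inv-f = record { load = y ∷ʳ 0ℚ ; balanced = balanced′ ; paid = paid′ }
    where
    y = load inv-f

    balanced′ : ∀ i → Balanced D (price (lookup rs i)) (lookup (f ∷ʳ 0ℚ) i) (lookup (y ∷ʳ 0ℚ) i)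
    balanced′ i = go (view i)
      where
      go : ∀ {i} → View i → Balanced D (price (lookup rs i)) (lookup (f ∷ʳ 0ℚ) i) (lookup (y ∷ʳ 0ℚ) i)
      go ‵fromℕ = subst₂ (Balanced D _) (sym (lookup-∷ʳ-fromℕ f 0ℚ)) (sym (lookup-∷ʳ-fromℕ y 0ℚ))
        (balanced-0 D (0≤price rs valid (fromℕ t)))
      go (‵inject₁ j) = subst₂ (Balanced D _) (sym (lookup-∷ʳ-inject₁ f 0ℚ j)) (sym (lookup-∷ʳ-inject₁ y 0ℚ j))
        (subst (λ r → Balanced D (price r) (lookup f j) (lookup y j)) (lookup-init rs j) (balanced inv-f j))

    Σ-∷ʳ-0 : ∀ (w : Fin (suc t) → ℚ) (w′ : Fin t → ℚ) (v : Vec ℚ t) → (∀ i → w′ i ≡ w (inject₁ i)) →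
      Σ (λ i → w′ i *ℚ lookup v i) ≡ Σ (λ i → w i *ℚ lookup (v ∷ʳ 0ℚ) i)
    Σ-∷ʳ-0 w w′ v eq = sym (trans (Σ-last (λ i → w i *ℚ lookup (v ∷ʳ 0ℚ) i)) (trans
      (cong₂ _+_ (Σ-cong (λ i → cong₂ _*ℚ_ (sym (eq i)) (lookup-∷ʳ-inject₁ v 0ℚ i)))
                 (trans (cong (w (fromℕ t) *ℚ_) (lookup-∷ʳ-fromℕ v 0ℚ)) (ℚₚ.*-zeroʳ (w (fromℕ t)))))
      (ℚₚ.+-identityʳ (Σ (λ i → w′ i *ℚ lookup v i)))))

    paid′ : ∀ f* → OfflineFeasible G rs f* → spent rs (f ∷ʳ 0ℚ) ≤ 2ℚ *ℚ Σ (λ i → lookup f* i *ℚ lookup (y ∷ʳ 0ℚ) i)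
    paid′ f* feasible = subst₂ (λ a b → a ≤ 2ℚ *ℚ b)
      (Σ-∷ʳ-0 (λ i → price (lookup rs i)) (λ i → price (lookup (init rs) i)) f (λ i → cong price (lookup-init rs i)))
      (Σ-∷ʳ-0 (lookup f*) (lookup (init f*)) y (lookup-init f*))
      (paid inv-f (init f*) (init-offline rs f* feasible))

  -- Feasibility, monotonicity and competitiveness of the run.

  run-invariant : (rs : Vec (Request G) t) → ValidSeq G rs → Invariant rs (run rs)
  extended-invariant : (rs : Vec (Request G) (suc t)) → ValidSeq G rs → Invariant rs (run (init rs) ∷ʳ 0ℚ)

  run-invariant {zero}  [] valid = record { load = [] ; balanced = λ () ; paid = λ _ _ → ℚₚ.≤-refl }
  run-invariant {suc t} rs valid = proj₁ (saturate-correct rs valid _ (extended-invariant rs valid))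

  extended-invariant rs valid = invariant-∷ʳ rs valid (run (init rs)) (run-invariant (init rs) (init-valid rs valid))

  run-feasible : (rs : Vec (Request G) t) → ValidSeq G rs → OnlineFeasible G rs (run rs)
  run-feasible {zero} [] valid e = ℚₚ.≤-trans (ℚₚ.≤-reflexive (ℚₚ.+-identityˡ (- ℕ→ℚ (cap G e))))
    (ℚₚ.neg-antimono-≤ (0≤ℕ→ℚ (cap G e)))
  run-feasible {suc t} rs valid = saturate-feasible rs valid _ (extended-invariant rs valid)

  run-monotone : (rs : Vec (Request G) t) (r : Request G) → ValidSeq G (rs ∷ʳ r) →
    ∀ i → lookup (run rs) i ≤ lookup (run (rs ∷ʳ r)) (inject₁ i)
  run-monotone rs r valid i = subst (_≤ lookup (run (rs ∷ʳ r)) (inject₁ i))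
    -- Removing `r` again gives back `rs`, so saturation starts from `run rs` padded with 0.
    (trans (lookup-∷ʳ-inject₁ (run (init (rs ∷ʳ r))) 0ℚ i) (cong (λ xs → lookup (run xs) i) (init-∷ʳ r rs)))
    (proj₂ (saturate-correct (rs ∷ʳ r) valid _ (extended-invariant (rs ∷ʳ r) valid)) (inject₁ i))

  module _ (rs : Vec (Request G) t) (valid : ValidSeq G rs) (f* : Vec ℚ t) (feasible : OfflineFeasible G rs f*) where

    private
      inv-run = run-invariant rs valid
      c = maxCap G

    -- Truncating weights at 1 only lowers the cost. The bound on each load is then multiplied by
    -- the nonnegative `f*` of its request and summed.
    run-competitive : algCost G rs (run rs) ≤ logBound 16 c *ℚ offCost G rs f*
    run-competitive = begin
      algCost G rs (run rs)
        ≤⟨ Σ-mono (λ i → *-monoˡ (price (lookup rs i)) (0≤price rs valid i) (ℚₚ.p⊓q≤p (lookup (run rs) i) 1ℚ)) ⟩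
      Σ (λ i → lookup (run rs) i *ℚ price (lookup rs i))
        ≡⟨ Σ-cong (λ i → ℚₚ.*-comm (lookup (run rs) i) (price (lookup rs i))) ⟩
      spent rs (run rs)
        ≤⟨ paid inv-run f* feasible ⟩
      2ℚ *ℚ Σ (λ i → lookup f* i *ℚ lookup (load inv-run) i)
        ≡⟨ Σ-* 2ℚ (λ i → lookup f* i *ℚ lookup (load inv-run) i) ⟨
      Σ (λ i → 2ℚ *ℚ (lookup f* i *ℚ lookup (load inv-run) i))
        ≤⟨ Σ-mono (λ i → charge (lookup f* i) (lookup (load inv-run) i) (price (lookup rs i)) (logBound 16 c)
             (proj₁ (proj₁ feasible i)) (balanced-load c (0≤price rs valid i) (balanced inv-run i))) ⟩
      Σ (λ i → logBound 16 c *ℚ (lookup f* i *ℚ price (lookup rs i)))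
        ≡⟨ Σ-* (logBound 16 c) (λ i → lookup f* i *ℚ price (lookup rs i)) ⟩
      logBound 16 c *ℚ offCost G rs f* ∎
      where
      open ≤-Reasoning
      open +-*-Solver
      charge : ∀ x y p B → 0ℚ ≤ x → 2ℚ *ℚ y ≤ B *ℚ p → 2ℚ *ℚ (x *ℚ y) ≤ B *ℚ (x *ℚ p)
      charge x y p B 0≤x h = subst₂ _≤_
        (solve 3 (λ x y c → x :* (c :* y) := c :* (x :* y)) refl x y 2ℚ)
        (solve 3 (λ x p B → x :* (B :* p) := B :* (x :* p)) refl x p B)
        (*-monoʳ x 0≤x h)

    run-competitive-mc : algCost G rs (run rs) ≤ logBound 16 (m G * c) *ℚ offCost G rs f*
    run-competitive-mc = ℚₚ.≤-trans run-competitive (*-monoˡ (offCost G rs f*)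
      -- Enlarging the factor from log c to log(mc) is sound because the offline cost is
      -- nonnegative.
      (Σ-nonneg (λ i → 0≤* (proj₁ (proj₁ feasible i)) (0≤price rs valid i)))
      (ℕ→ℚ-mono (ℕₚ.*-monoʳ-≤ 16 (s≤s (⌊log₂⌋-mono-≤ (max≤n*max (m G) (cap G)))))))

theorem1 : Σ[ K ∈ ℕ ] Σ[ A ∈ ((G : Graph) → Algorithm G) ]
    ((G : Graph) → WellFormed G →
    ValidOnline G (A G)
    × ({t : ℕ} (rs : Vec (Request G) t) → ValidSeq G rs →
    (fstar : Vec ℚ t) → OfflineFeasible G rs fstar →
    algCost G rs (A G rs) ≤ logBound K (m G * maxCap G) *ℚ offCost G rs fstar)
    × ({t : ℕ} (rs : Vec (Request G) t) → ValidSeq G rs → AllUnitCost G rs →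
    (fstar : Vec ℚ t) → OfflineFeasible G rs fstar →
    algCost G rs (A G rs) ≤ logBound K (maxCap G) *ℚ offCost G rs fstar))
-- One algorithm and one constant, the 16 of `balanced-load`, serve both bounds.
theorem1 = 16 , (λ G → run G) , λ G _ →
  ( (λ rs valid → (λ i → nonneg (Invariant.balanced (run-invariant G rs valid) i)) , run-feasible G rs valid)
  , run-monotone G )
  , (λ rs valid f* feasible → run-competitive-mc G rs valid f* feasible)
  , (λ rs valid _ f* feasible → run-competitive G rs valid f* feasible)
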